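{- Let $F$ be the simplicial complex on vertex set $\{v_1,\dots,v_6\}$ whose edge set is the downward closure of $\{v_1v_2v_3,\ v_4v_5v_6,\ v_1v_4\}$. There is $C\in\mathbb N$ such that for every positive integer $n$, $$n^2-n+2\le \mathrm{ex}(n,F)\le n^2-n+C.$$
   Context: A simplicial complex is a pair $H=(V,E)$ with $E\subseteq\mathscr P(V)$ closed under taking subsets; all sets in $E$ (including the empty set and singletons) count as edges. $H$ contains a copy of $F$ if there is an injection $\varphi:V(F)\to V(H)$ with $\varphi(e)\in E(H)$ for every $e\in E(F)$. $\mathrm{ex}(n,F)$ is the maximum number of edges of a simplicial complex on $n$ vertices containing no copy of $F$. -}

module Defs where

open import Data.Nat using (ℕ; zero; suc; _+_; _*_; _∸_; _≤_)
open import Data.Bool using (Bool; true; false; if_then_else_; _∨_)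
open import Data.Fin using (Fin; zero; suc)
open import Data.Fin.Subset using (Subset; _⊆_; _∪_; ⁅_⁆; ⊥; inside; outside)
open import Data.Fin.Subset.Properties using (_⊆?_)
open import Data.List using (List; []; _∷_; map; _++_)
open import Data.Nat.ListAction using (sum)
open import Data.Vec using (Vec; []; _∷_)
open import Relation.Nullary using (does; yes; no)
open import Relation.Binary.PropositionalEquality using (_≡_; refl; cong)
open import Data.Bool.Properties using (∨-zeroʳ)
open import Data.Empty using () renaming (⊥-elim to ⊥-elim)
open import Data.Fin.Subset.Properties using (⊆-trans)
open import Function using (_∘_)
open import Function.Definitions using (Injective)

record Complex (n : ℕ) : Set where
  field
    edge : Subset n → Bool
    down-closed : ∀ (s t : Subset n) → t ⊆ s → edge s ≡ true → edge t ≡ true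
open Complex public

allSubsets : (n : ℕ) → List (Subset n)
allSubsets zero = [] ∷ []
allSubsets (suc n) = map (outside ∷_) (allSubsets n) ++ map (inside ∷_) (allSubsets n)

-- number of edges (all edges count, including ∅ and singletons)
numEdges : ∀ {n} → Complex n → ℕ
numEdges {n} H = sum (map (λ s → if edge H s then 1 else 0) (allSubsets n))

image : ∀ {m n} → (Fin m → Fin n) → Subset m → Subset n
image {zero}  φ []      = ⊥
image {suc m} φ (b ∷ s) = (if b then ⁅ φ zero ⁆ else ⊥) ∪ image (φ ∘ suc) s

ContainsCopy : ∀ {m n} → Complex n → Complex m → Set
ContainsCopy {m} {n} H F =
  Σ' (Fin m → Fin n) λ φ → Injective _≡_ _≡_ φ ×' (∀ (e : Subset m) → edge F e ≡ true → edge H (image φ e) ≡ true)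
  where
    open import Data.Product using () renaming (Σ to Σ'; _×_ to _×'_)

F-tri₁ F-tri₂ F-pair : Subset 6
F-tri₁ = inside ∷ inside ∷ inside ∷ outside ∷ outside ∷ outside ∷ []
F-tri₂ = outside ∷ outside ∷ outside ∷ inside ∷ inside ∷ inside ∷ []
F-pair = inside ∷ outside ∷ outside ∷ inside ∷ outside ∷ outside ∷ []

F-edge : Subset 6 → Bool
F-edge s = does (s ⊆? F-tri₁) ∨ does (s ⊆? F-tri₂) ∨ does (s ⊆? F-pair)

private
  dc : ∀ (A s t : Subset 6) → t ⊆ s → does (s ⊆? A) ≡ true → does (t ⊆? A) ≡ true
  dc A s t t⊆s h with s ⊆? A | t ⊆? A
  ... | _ | yes _ = refl
  ... | yes s⊆A | no ¬t = ⊥-elim (¬t (⊆-trans t⊆s s⊆A))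
  ... | no _ | no _ = h

  F-dc : ∀ (s t : Subset 6) → t ⊆ s → F-edge s ≡ true → F-edge t ≡ true
  F-dc s t t⊆s h with s ⊆? F-tri₁ in e1 | s ⊆? F-tri₂ in e2 | s ⊆? F-pair in e3
  ... | yes p | _ | _ rewrite dc F-tri₁ s t t⊆s (cong does e1) = refl
  ... | no _ | yes p | _ rewrite dc F-tri₂ s t t⊆s (cong does e2) | ∨-zeroʳ (does (t ⊆? F-tri₁)) = refl
  ... | no _ | no _ | yes p rewrite dc F-pair s t t⊆s (cong does e3) | ∨-zeroʳ (does (t ⊆? F-tri₂)) | ∨-zeroʳ (does (t ⊆? F-tri₁)) = refl
  ... | no _ | no _ | no _ with () ← h

F : Complex 6
F = record { edge = F-edge ; down-closed = F-dc }

{-# OPTIONS --safe #-}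

-- Lower bound: the cone over the complete graph, in which every triangle contains the apex.
--
-- Upper bound: delete a vertex lying in at most 2(n − 1) edges and induct; the bound drops by
-- exactly 2(n − 1).  If n is large and every vertex lies in more edges, then each vertex v lies
-- in a triangle leaving any prescribed bounded set, and in a triangle avoiding any prescribed
-- w ≠ v.  F-freeness says that disjoint triangles are not joined by an edge, so all triangles at
-- a vertex w meet every triangle adjacent to w.  Pigeonhole then gives a pair wx lying in many
-- triangles wxy; all triangles at such a y meet {w , x}, so again by pigeonhole yw (say) lies in
-- many triangles.  This forces all but at most one triangle at the other such y′ to contain w,
-- hence y′w lies in many triangles too, and then all triangles at a third y″ contain w.
module Submission where

open import Defs
open import Data.Nat using (ℕ; zero; suc; _+_; _*_; _∸_; _^_; _≤_; _<_; _≤?_; _<ᵇ_; z≤n; s≤s; NonZero)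
open import Data.Nat.Properties using (≤-refl; ≤-reflexive; ≤-trans; ≤-pred; <⇒≱; ≰⇒>; m≤m+n; m≤n+m; +-mono-≤; +-monoˡ-≤; +-monoʳ-≤; +-comm; +-suc; +-commutativeSemigroup; +-identityʳ; m+n∸m≡n; m∸n+n≡m; *-suc; ^-monoʳ-≤; <ᵇ⇒<; <⇒<ᵇ; module ≤-Reasoning)
open import Algebra.Properties.CommutativeSemigroup +-commutativeSemigroup using (interchange)
open import Data.Nat.Tactic.RingSolver using (solve-∀)
open import Data.Nat.ListAction using (sum)
open import Data.Nat.ListAction.Properties using (sum-++)
open import Data.Bool using (Bool; true; false; if_then_else_)
open import Data.Bool.Properties using (T-≡)
open import Data.Empty using (⊥-elim) renaming (⊥ to Absurd)
open import Data.Fin using (Fin; zero; suc; punchIn; punchOut; _≟_)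
open import Data.Fin.Properties using (any?; punchIn-injective; punchIn-punchOut; punchOut-injective)
open import Data.Fin.Subset using (Subset; inside; outside; _∈_; _∉_; _⊆_; _∪_; _∩_; ⁅_⁆; ⊥; ∣_∣; _-_)
open import Data.Fin.Subset.Properties using (_∈?_; _⊆?_; ∉⊥; x∈⁅x⁆; x∈⁅y⁆⇒x≡y; ⊆-antisym; p⊆q⇒∣p∣≤∣q∣; drop-∷-⊆; drop-there; x∈p∪q⁺; x∈p∪q⁻; x∈p∧x≢y⇒x∈p-y; x∈p⇒∣p-x∣<∣p∣; p∩q⊆p; p∩q⊆q; x∈p∩q⁺; anySubset?)
open import Data.List using (List; []; _∷_; map; _++_; length; foldr; allFin)
open import Data.List.Properties using (map-++; map-∘; length-map; length-++; length-tabulate)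
open import Data.List.Membership.Propositional using () renaming (_∈_ to _∈ₗ_; _∉_ to _∉ₗ_)
open import Data.List.Membership.Propositional.Properties using (∈-map⁺; ∈-++⁺ˡ; ∈-++⁺ʳ; ∈-allFin)
open import Data.List.Relation.Unary.Any using (here; there)
open import Data.List.Relation.Unary.All as All using (All; []; _∷_; all?)
open import Data.List.Relation.Unary.All.Properties using (¬Any⇒All¬; ++⁻ˡ; ++⁻ʳ)
open import Data.Product using (Σ; _×_; ∃; ∃₂; _,_)
open import Data.Sum using (inj₁; inj₂)
open import Data.Vec using ([]; _∷_; lookup; insertAt; removeAt)
open import Data.Vec.Base using (here; there)
open import Data.Vec.Properties using (≡-dec; []=⇒lookup; lookup⇒[]=; insertAt-lookup; insertAt-punchIn; removeAt-insertAt)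
open import Data.Vec.Relation.Unary.All using ([]; _∷_)
open import Data.Vec.Relation.Unary.AllPairs using ([]; _∷_)
open import Data.Vec.Relation.Unary.Unique.Propositional using (Unique)
open import Data.Vec.Relation.Unary.Unique.Propositional.Properties using (lookup-injective)
open import Function using (_∘_; id; Equivalence)
open import Relation.Binary.PropositionalEquality using (_≡_; _≢_; refl; sym; trans; cong; cong₂; subst; ≢-sym)
open import Relation.Nullary using (¬_; yes; no; contradiction; ¬?; _×-dec_)
open import Relation.Nullary.Decidable using (decidable-stable)
import Data.Bool.Properties as Bool
import Data.List.Membership.DecPropositional as DecMembership

private variable
  m n k : ℕ

-- Sums over all subsets

∑ : (Subset n → ℕ) → ℕ
∑ f = sum (map f (allSubsets _))

⟦_⟧ : Bool → ℕ
⟦ b ⟧ = if b then 1 else 0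

∑-suc : (f : Subset (suc n) → ℕ) → ∑ f ≡ ∑ (f ∘ (outside ∷_)) + ∑ (f ∘ (inside ∷_))
∑-suc {n} f
  rewrite map-++ f (map (outside ∷_) (allSubsets n)) (map (inside ∷_) (allSubsets n))
        | sum-++ (map f (map (outside ∷_) (allSubsets n))) (map f (map (inside ∷_) (allSubsets n)))
        | map-∘ {g = f} {f = outside ∷_} (allSubsets n)
        | map-∘ {g = f} {f = inside ∷_} (allSubsets n) = refl

∑-insertAt : ∀ v (f : Subset (suc n) → ℕ) →
  ∑ f ≡ ∑ (λ s → f (insertAt s v outside)) + ∑ (λ s → f (insertAt s v inside))
∑-insertAt zero f = ∑-suc f
∑-insertAt {suc n} (suc v) f
  rewrite ∑-suc f
        | ∑-insertAt v (f ∘ (outside ∷_))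
        | ∑-insertAt v (f ∘ (inside ∷_))
        | ∑-suc (λ s → f (insertAt s (suc v) outside))
        | ∑-suc (λ s → f (insertAt s (suc v) inside)) =
  interchange (∑ λ s → f (outside ∷ insertAt s v outside)) _ _ _

∑-mono : {f g : Subset n → ℕ} → (∀ s → f s ≤ g s) → ∑ f ≤ ∑ g
∑-mono {zero} f≤g = +-monoˡ-≤ 0 (f≤g [])
∑-mono {suc n} {f} {g} f≤g rewrite ∑-suc f | ∑-suc g =
  +-mono-≤ (∑-mono (f≤g ∘ (outside ∷_))) (∑-mono (f≤g ∘ (inside ∷_)))

∑-0 : ∑ {n} (λ _ → 0) ≡ 0
∑-0 {zero} = refl
∑-0 {suc n} rewrite ∑-suc {n} (λ _ → 0) | ∑-0 {n} = refl

∑-+ : (f g : Subset n → ℕ) → ∑ (λ s → f s + g s) ≡ ∑ f + ∑ g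
∑-+ {zero} f g = reassoc (f []) (g [])
  where
  reassoc : ∀ a b → a + b + 0 ≡ a + 0 + (b + 0)
  reassoc = solve-∀
∑-+ {suc n} f g
  rewrite ∑-suc (λ s → f s + g s) | ∑-suc f | ∑-suc g
        | ∑-+ (f ∘ (outside ∷_)) (g ∘ (outside ∷_))
        | ∑-+ (f ∘ (inside ∷_)) (g ∘ (inside ∷_)) =
  interchange (∑ (f ∘ (outside ∷_))) _ _ _

∑-bool≤2^n : (p : Subset n → Bool) → ∑ (⟦_⟧ ∘ p) ≤ 2 ^ n
∑-bool≤2^n {zero} p with p []
... | true = s≤s z≤n
... | false = z≤n
∑-bool≤2^n {suc n} p
  rewrite ∑-suc (⟦_⟧ ∘ p) | +-identityʳ (2 ^ n) =
  +-mono-≤ (∑-bool≤2^n (p ∘ (outside ∷_))) (∑-bool≤2^n (p ∘ (inside ∷_)))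

δ : Subset n → Subset n → ℕ
δ [] [] = 1
δ (true ∷ s) (true ∷ t) = δ s t
δ (false ∷ s) (false ∷ t) = δ s t
δ (_ ∷ _) (_ ∷ _) = 0

δ-refl : (s : Subset n) → δ s s ≡ 1
δ-refl [] = refl
δ-refl (true ∷ s) = δ-refl s
δ-refl (false ∷ s) = δ-refl s

∑-δ : (s : Subset n) → ∑ (δ s) ≡ 1
∑-δ [] = refl
∑-δ {suc n} (true ∷ s) rewrite ∑-suc (δ (true ∷ s)) | ∑-0 {n} = ∑-δ s
∑-δ {suc n} (false ∷ s) rewrite ∑-suc (δ (false ∷ s)) | ∑-0 {n} | ∑-δ s = refl

multiplicity : List (Subset n) → Subset n → ℕ
multiplicity [] s = 0
multiplicity (t ∷ L) s = δ t s + multiplicity L s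

∑-multiplicity : (L : List (Subset n)) → ∑ (multiplicity L) ≡ length L
∑-multiplicity {n} [] = ∑-0 {n}
∑-multiplicity (t ∷ L) rewrite ∑-+ (δ t) (multiplicity L) | ∑-δ t | ∑-multiplicity L = refl

∈⇒1≤multiplicity : ∀ {L} {s : Subset n} → s ∈ₗ L → 1 ≤ multiplicity L s
∈⇒1≤multiplicity {L = t ∷ L} (here refl) rewrite δ-refl t = s≤s z≤n
∈⇒1≤multiplicity {L = t ∷ L} {s} (there s∈L) = ≤-trans (∈⇒1≤multiplicity s∈L) (m≤n+m _ (δ t s))

-- The indicator of `p` is at most `multiplicity L`, whose total over all subsets is `length L`.
-- Repetitions in `L` only weaken the bound, so covering lists need not be duplicate-free.
∑-cover : (p : Subset n → Bool) (L : List (Subset n)) → (∀ s → p s ≡ true → s ∈ₗ L) →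
  ∑ (⟦_⟧ ∘ p) ≤ length L
∑-cover p L covers = ≤-trans (∑-mono pointwise) (≤-reflexive (∑-multiplicity L))
  where
  pointwise : ∀ s → ⟦ p s ⟧ ≤ multiplicity L s
  pointwise s with p s in ps
  ... | true = ∈⇒1≤multiplicity (covers s ps)
  ... | false = z≤n

-- The cone over the complete graph

-- The sum of the binomial coefficients of `n` below index `k`; `smallSets-suc` is Pascal's rule for
-- it.
smallSets : ℕ → ℕ → ℕ
smallSets n k = ∑ {n} λ s → ⟦ ∣ s ∣ <ᵇ k ⟧

smallSets-suc : ∀ n k → smallSets (suc n) (suc k) ≡ smallSets n (suc k) + smallSets n k
smallSets-suc n k = ∑-suc {n} λ s → ⟦ ∣ s ∣ <ᵇ suc k ⟧

smallSets-0 : ∀ n → smallSets n 0 ≡ 0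
smallSets-0 n = ∑-0 {n}

smallSets-1 : ∀ n → smallSets n 1 ≡ 1
smallSets-1 zero = refl
smallSets-1 (suc n) rewrite smallSets-suc n 0 | smallSets-1 n | smallSets-0 n = refl

smallSets-2 : ∀ n → smallSets n 2 ≡ suc n
smallSets-2 zero = refl
smallSets-2 (suc n) rewrite smallSets-suc n 1 | smallSets-2 n | smallSets-1 n = +-comm (suc n) 1

-- Doubling avoids a division by two and yields the edge count of the cone directly: each set of at
-- most two base vertices occurs with and without the apex, which is vertex `zero`.
smallSets-3 : ∀ n → smallSets n 3 + smallSets n 3 ≡ n * suc n + 2
smallSets-3 zero = refl
smallSets-3 (suc n) rewrite smallSets-suc n 2 | smallSets-2 n =
  trans (step₁ (smallSets n 3) n) (trans (cong (_+ (suc n + suc n)) (smallSets-3 n)) (step₂ n))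
  where
  step₁ : ∀ a n → a + suc n + (a + suc n) ≡ a + a + (suc n + suc n)
  step₁ = solve-∀
  step₂ : ∀ n → n * suc n + 2 + (suc n + suc n) ≡ suc n * suc (suc n) + 2
  step₂ = solve-∀

n*n∸n : ∀ m → suc m * suc m ∸ suc m ≡ m * suc m
n*n∸n m = m+n∸m≡n (suc m) (m * suc m)

cone : Complex (suc m)
cone .edge (_ ∷ s) = ∣ s ∣ <ᵇ 3
cone .down-closed (_ ∷ s) (_ ∷ t) t⊆s s<3 =
  Equivalence.to T-≡ (<⇒<ᵇ (≤-trans (s≤s (p⊆q⇒∣p∣≤∣q∣ (drop-∷-⊆ t⊆s)))
    (<ᵇ⇒< ∣ s ∣ 3 (Equivalence.from T-≡ s<3))))

numEdges-cone : ∀ m → numEdges (cone {m}) ≡ suc m * suc m ∸ suc m + 2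
numEdges-cone m rewrite n*n∸n m =
  trans (∑-suc (⟦_⟧ ∘ edge (cone {m}))) (smallSets-3 m)

∈-image⁺ : (φ : Fin m → Fin n) (s : Subset m) {i : Fin m} → i ∈ s → φ i ∈ image φ s
∈-image⁺ φ (_ ∷ s) here = x∈p∪q⁺ (inj₁ (x∈⁅x⁆ _))
∈-image⁺ φ (_ ∷ s) (there i∈s) = x∈p∪q⁺ (inj₂ (∈-image⁺ (φ ∘ suc) s i∈s))

∈-image⁻ : (φ : Fin m → Fin n) (s : Subset m) {x : Fin n} → x ∈ image φ s →
  ∃ λ i → i ∈ s × φ i ≡ x
∈-image⁻ φ [] x∈ = contradiction x∈ ∉⊥
∈-image⁻ φ (b ∷ s) x∈ with x∈p∪q⁻ (if b then ⁅ φ zero ⁆ else ⊥) _ x∈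
∈-image⁻ φ (true ∷ s) x∈ | inj₁ x∈φ0 = zero , here , sym (x∈⁅y⁆⇒x≡y _ x∈φ0)
∈-image⁻ φ (false ∷ s) x∈ | inj₁ x∈⊥ = contradiction x∈⊥ ∉⊥
... | inj₂ x∈φs with i , i∈s , φi≡x ← ∈-image⁻ (φ ∘ suc) s x∈φs = suc i , there i∈s , φi≡x

three-members : {s : Subset n} {a b c : Fin n} → a ∈ s → b ∈ s → c ∈ s →
  a ≢ b → a ≢ c → b ≢ c → 3 ≤ ∣ s ∣
three-members {s = s} {a} {b} a∈s b∈s c∈s a≢b a≢c b≢c = begin
  3                      ≤⟨ s≤s (s≤s (s≤s z≤n)) ⟩
  3 + ∣ s - a - b - _ ∣  ≤⟨ s≤s (s≤s (x∈p⇒∣p-x∣<∣p∣ c∈)) ⟩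
  2 + ∣ s - a - b ∣      ≤⟨ s≤s (x∈p⇒∣p-x∣<∣p∣ b∈) ⟩
  1 + ∣ s - a ∣          ≤⟨ x∈p⇒∣p-x∣<∣p∣ a∈s ⟩
  ∣ s ∣                  ∎
  where
  open ≤-Reasoning
  b∈ = x∈p∧x≢y⇒x∈p-y b∈s (≢-sym a≢b)
  c∈ = x∈p∧x≢y⇒x∈p-y (x∈p∧x≢y⇒x∈p-y c∈s (≢-sym a≢c)) (≢-sym b≢c)

cone-triangle : {s : Subset (suc m)} {a b c : Fin (suc m)} → edge cone s ≡ true →
  a ∈ s → b ∈ s → c ∈ s → a ≢ b → a ≢ c → b ≢ c → zero ∈ s
cone-triangle {a = zero} e a∈ b∈ c∈ _ _ _ = a∈
cone-triangle {b = zero} e a∈ b∈ c∈ _ _ _ = b∈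
cone-triangle {c = zero} e a∈ b∈ c∈ _ _ _ = c∈
cone-triangle {s = _ ∷ s} {suc a} {suc b} {suc c} e a∈ b∈ c∈ a≢b a≢c b≢c =
  contradiction
    (three-members (drop-there a∈) (drop-there b∈) (drop-there c∈)
      (a≢b ∘ cong suc) (a≢c ∘ cong suc) (b≢c ∘ cong suc))
    (<⇒≱ (<ᵇ⇒< ∣ s ∣ 3 (Equivalence.from T-≡ e)))

-- The images of both triangles of `F` contain the apex. By injectivity it has a single preimage,
-- yet the triangles are disjoint.
cone-F-free : ¬ ContainsCopy (cone {m}) F
cone-F-free (φ , inj , pres)
  with i , i∈ , φi≡0 ← ∈-image⁻ φ F-tri₁ (cone-triangle (pres F-tri₁ refl)
         (∈-image⁺ φ F-tri₁ here) (∈-image⁺ φ F-tri₁ (there here))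
         (∈-image⁺ φ F-tri₁ (there (there here)))
         (λ e → contradiction (inj e) λ ()) (λ e → contradiction (inj e) λ ())
         (λ e → contradiction (inj e) λ ()))
     | j , j∈ , φj≡0 ← ∈-image⁻ φ F-tri₂ (cone-triangle (pres F-tri₂ refl)
         (∈-image⁺ φ F-tri₂ (there (there (there here))))
         (∈-image⁺ φ F-tri₂ (there (there (there (there here)))))
         (∈-image⁺ φ F-tri₂ (there (there (there (there (there here))))))
         (λ e → contradiction (inj e) λ ()) (λ e → contradiction (inj e) λ ())
         (λ e → contradiction (inj e) λ ()))
  with refl ← inj (trans φi≡0 (sym φj≡0)) = disjoint i∈ j∈
  where
  disjoint : ∀ {i} → i ∈ F-tri₁ → i ∉ F-tri₂
  disjoint here ()
  disjoint (there here) (there ())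
  disjoint (there (there here)) (there (there ()))
  disjoint (there (there (there (there (there (there ()))))))

-- Deletion of a vertex

∈-insertAt⁺ : (s : Subset n) (v : Fin (suc n)) (b : Bool) {x : Fin n} →
  x ∈ s → punchIn v x ∈ insertAt s v b
∈-insertAt⁺ s v b {x} x∈s =
  lookup⇒[]= _ _ (trans (insertAt-punchIn s v b x) ([]=⇒lookup x∈s))

∈-insertAt-outside⁻ : (s : Subset n) (v : Fin (suc n)) {x : Fin (suc n)} →
  x ∈ insertAt s v outside → ∃ λ y → y ∈ s × punchIn v y ≡ x
∈-insertAt-outside⁻ s v {x} x∈ with v ≟ x
... | yes refl with () ← trans (sym (insertAt-lookup s v outside)) ([]=⇒lookup x∈)
... | no v≢x = y , lookup⇒[]= y s (trans (sym (insertAt-punchIn s v outside y)) y∈) , eq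
  where
  y = punchOut v≢x
  eq = punchIn-punchOut v≢x
  y∈ = trans (cong (lookup (insertAt s v outside)) eq) ([]=⇒lookup x∈)

v∈insertAt-inside : (s : Subset n) (v : Fin (suc n)) → v ∈ insertAt s v inside
v∈insertAt-inside s v = lookup⇒[]= v _ (insertAt-lookup s v inside)

delete : Complex (suc n) → Fin (suc n) → Complex n
delete H v .edge s = edge H (insertAt s v outside)
delete H v .down-closed s t t⊆s = down-closed H _ _ insert⊆
  where
  insert⊆ : insertAt t v outside ⊆ insertAt s v outside
  insert⊆ x∈ with y , y∈t , refl ← ∈-insertAt-outside⁻ t v x∈ = ∈-insertAt⁺ s v outside (t⊆s y∈t)

delete-copy : {G : Complex k} (H : Complex (suc n)) (v : Fin (suc n)) →
  ContainsCopy (delete H v) G → ContainsCopy H G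
delete-copy H v (φ , inj , pres) =
  punchIn v ∘ φ ,
  (λ eq → inj (punchIn-injective v _ _ eq)) ,
  λ e e∈G → down-closed H _ _ (image⊆ e) (pres e e∈G)
  where
  image⊆ : ∀ e → image (punchIn v ∘ φ) e ⊆ insertAt (image φ e) v outside
  image⊆ e x∈ with i , i∈e , refl ← ∈-image⁻ (punchIn v ∘ φ) e x∈ =
    ∈-insertAt⁺ (image φ e) v outside (∈-image⁺ φ e i∈e)

degree : Complex (suc n) → Fin (suc n) → ℕ
degree H v = ∑ λ s → ⟦ edge H (insertAt s v inside) ⟧

numEdges-delete : (H : Complex (suc n)) (v : Fin (suc n)) →
  numEdges H ≡ numEdges (delete H v) + degree H v
numEdges-delete H v = ∑-insertAt v (⟦_⟧ ∘ edge H)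

-- Otherwise `L` contains all edges at `v`, and deleting `v` from its members gives an equally long
-- list covering the link of `v`, so `∑-cover` bounds the degree. Lower bounds on degrees enter the
-- proof only through this lemma.
degree-uncovered : (H : Complex (suc n)) (v : Fin (suc n)) (L : List (Subset (suc n))) →
  length L < degree H v → ∃ λ s → v ∈ s × edge H s ≡ true × s ∉ₗ L
degree-uncovered H v L L<deg with anySubset? uncovered?
  where
  open DecMembership (≡-dec Bool._≟_) renaming (_∈?_ to _∈ₗ?_)
  uncovered? = λ s → (edge H (insertAt s v inside) Bool.≟ true) ×-dec ¬? (insertAt s v inside ∈ₗ? L)
... | yes (s , e , s∉L) = insertAt s v inside , v∈insertAt-inside s v , e , s∉L
... | no all-covered = contradiction
  (≤-trans (∑-cover _ (map (λ t → removeAt t v) L) covered) (≤-reflexive (length-map _ L)))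
  (<⇒≱ L<deg)
  where
  open DecMembership (≡-dec Bool._≟_) renaming (_∈?_ to _∈ₗ?_)
  covered : ∀ s → edge H (insertAt s v inside) ≡ true → s ∈ₗ map (λ t → removeAt t v) L
  covered s e = subst (_∈ₗ _) (removeAt-insertAt s v inside) (∈-map⁺ (λ t → removeAt t v)
    (decidable-stable (insertAt s v inside ∈ₗ? L) λ s∉L → all-covered (s , e , s∉L)))

-- Subsets given by lists of vertices

setOf : List (Fin n) → Subset n
setOf = foldr (λ x → ⁅ x ⁆ ∪_) ⊥

∈-setOf⁺ : ∀ {xs} {x : Fin n} → x ∈ₗ xs → x ∈ setOf xs
∈-setOf⁺ (here refl) = x∈p∪q⁺ (inj₁ (x∈⁅x⁆ _))
∈-setOf⁺ (there x∈xs) = x∈p∪q⁺ (inj₂ (∈-setOf⁺ x∈xs))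

∈-setOf⁻ : ∀ xs {x : Fin n} → x ∈ setOf xs → x ∈ₗ xs
∈-setOf⁻ [] x∈ = contradiction x∈ ∉⊥
∈-setOf⁻ (y ∷ xs) x∈ with x∈p∪q⁻ ⁅ y ⁆ _ x∈
... | inj₁ x∈y = here (x∈⁅y⁆⇒x≡y y x∈y)
... | inj₂ x∈xs = there (∈-setOf⁻ xs x∈xs)

setOf⊆ : ∀ xs {s : Subset n} → All (_∈ s) xs → setOf xs ⊆ s
setOf⊆ xs all∈s x∈ = All.lookup all∈s (∈-setOf⁻ xs x∈)

outside-member : (s : Subset n) (xs : List (Fin n)) →
  ¬ s ⊆ setOf xs → ∃ λ a → a ∈ s × All (a ≢_) xs
outside-member s xs s⊈xs with any? (λ a → (a ∈? s) ×-dec all? (λ x → ¬? (a ≟ x)) xs)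
... | yes found = found
... | no none = ⊥-elim (s⊈xs s⊆xs)
  where
  open DecMembership (_≟_ {_}) renaming (_∈?_ to _∈ₗ?_)
  s⊆xs : s ⊆ setOf xs
  s⊆xs {a} a∈s with a ∈ₗ? xs
  ... | yes a∈xs = ∈-setOf⁺ a∈xs
  ... | no a∉xs = contradiction (a , a∈s , ¬Any⇒All¬ xs a∉xs) none

extra-member : (s : Subset n) (xs : List (Fin n)) →
  All (_∈ s) xs → setOf xs ≢ s → ∃ λ a → a ∈ s × All (a ≢_) xs
extra-member s xs xs⊆s xs≢s =
  outside-member s xs λ s⊆xs → xs≢s (⊆-antisym (setOf⊆ xs xs⊆s) s⊆xs)

powerset : List (Fin n) → List (Subset n)
powerset [] = ⊥ ∷ []
powerset (x ∷ xs) = powerset xs ++ map (⁅ x ⁆ ∪_) (powerset xs)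

length-powerset : (xs : List (Fin n)) → length (powerset xs) ≡ 2 ^ length xs
length-powerset [] = refl
length-powerset (x ∷ xs)
  rewrite length-++ (powerset xs) {map (⁅ x ⁆ ∪_) (powerset xs)}
        | length-map (⁅ x ⁆ ∪_) (powerset xs)
        | length-powerset xs
        | +-identityʳ (2 ^ length xs) = refl

∈-powerset : ∀ xs {s : Subset n} → s ⊆ setOf xs → s ∈ₗ powerset xs
∈-powerset [] s⊆ = here (⊆-antisym s⊆ λ x∈⊥ → contradiction x∈⊥ ∉⊥)
∈-powerset (x ∷ xs) {s} s⊆ with x ∈? s
... | no x∉s = ∈-++⁺ˡ (∈-powerset xs s⊆xs)
  where
  s⊆xs : s ⊆ setOf xs
  s⊆xs y∈s with x∈p∪q⁻ ⁅ x ⁆ _ (s⊆ y∈s)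
  ... | inj₁ y∈x = contradiction (subst (_∈ s) (x∈⁅y⁆⇒x≡y x y∈x) y∈s) x∉s
  ... | inj₂ y∈xs = y∈xs
... | yes x∈s = ∈-++⁺ʳ (powerset xs)
  (subst (_∈ₗ _) (⊆-antisym ∪⊆s s⊆∪) (∈-map⁺ (⁅ x ⁆ ∪_) (∈-powerset xs (p∩q⊆q s (setOf xs)))))
  where
  ∪⊆s : ⁅ x ⁆ ∪ (s ∩ setOf xs) ⊆ s
  ∪⊆s y∈ with x∈p∪q⁻ ⁅ x ⁆ _ y∈
  ... | inj₁ y∈x = subst (_∈ s) (sym (x∈⁅y⁆⇒x≡y x y∈x)) x∈s
  ... | inj₂ y∈∩ = p∩q⊆p s (setOf xs) y∈∩
  s⊆∪ : s ⊆ ⁅ x ⁆ ∪ (s ∩ setOf xs)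
  s⊆∪ y∈s with x∈p∪q⁻ ⁅ x ⁆ _ (s⊆ y∈s)
  ... | inj₁ y∈x = x∈p∪q⁺ (inj₁ y∈x)
  ... | inj₂ y∈xs = x∈p∪q⁺ (inj₂ (x∈p∩q⁺ (y∈s , y∈xs)))

-- Triangles

Face : Complex n → List (Fin n) → Set
Face H xs = edge H (setOf xs) ≡ true

face-⊆ : (H : Complex n) {xs : List (Fin n)} {s : Subset n} →
  All (_∈ s) xs → edge H s ≡ true → Face H xs
face-⊆ H {xs} xs⊆s = down-closed H _ _ (setOf⊆ xs xs⊆s)

subface : (H : Complex n) {xs : List (Fin n)} (ys : List (Fin n)) →
  All (_∈ₗ ys) xs → Face H ys → Face H xs
subface H ys xs⊆ys = face-⊆ H (All.map ∈-setOf⁺ xs⊆ys)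

record Triangle (H : Complex n) (a b c : Fin n) : Set where
  constructor triangle
  field
    a≢b : a ≢ b
    a≢c : a ≢ c
    b≢c : b ≢ c
    face : Face H (a ∷ b ∷ c ∷ [])

module _ {H : Complex n} where

  private
    pattern 0th = here refl
    pattern 1st = there 0th
    pattern 2nd = there 1st

  swap₁₂ : ∀ {a b c} → Triangle H a b c → Triangle H b a c
  swap₁₂ (triangle a≢b a≢c b≢c face) =
    triangle (≢-sym a≢b) b≢c a≢c (subface H (_ ∷ _ ∷ _ ∷ []) (1st ∷ 0th ∷ 2nd ∷ []) face)

  swap₂₃ : ∀ {a b c} → Triangle H a b c → Triangle H a c b
  swap₂₃ (triangle a≢b a≢c b≢c face) =
    triangle a≢c a≢b (≢-sym b≢c) (subface H (_ ∷ _ ∷ _ ∷ []) (0th ∷ 2nd ∷ 1st ∷ []) face)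

  triangle-edge : ∀ {a b c} → Triangle H a b c → Face H (a ∷ b ∷ [])
  triangle-edge t = subface H (_ ∷ _ ∷ _ ∷ []) (0th ∷ 1st ∷ []) (Triangle.face t)

-- `a` and `d` play the roles of v₁ and v₄. By downward closure, the image of an edge of `F` only
-- has to lie inside one of the three given faces.
joined-triangles : (H : Complex n) {a b c d e f : Fin n} →
  Unique (a ∷ b ∷ c ∷ d ∷ e ∷ f ∷ []) →
  Face H (a ∷ b ∷ c ∷ []) → Face H (d ∷ e ∷ f ∷ []) → Face H (a ∷ d ∷ []) →
  ContainsCopy H F
joined-triangles {n} H {a} {b} {c} {d} {e} {f} unique abc def ad =
  φ , (λ {i} {j} → lookup-injective unique i j) , preserves
  where
  φ : Fin 6 → Fin n
  φ = lookup (a ∷ b ∷ c ∷ d ∷ e ∷ f ∷ [])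
  image⊆ : ∀ (s t : Subset 6) xs → (∀ i → i ∈ t → φ i ∈ₗ xs) → s ⊆ t → image φ s ⊆ setOf xs
  image⊆ s t xs φt⊆xs s⊆t x∈ with i , i∈s , refl ← ∈-image⁻ φ s x∈ = ∈-setOf⁺ (φt⊆xs i (s⊆t i∈s))
  on-tri₁ : ∀ i → i ∈ F-tri₁ → φ i ∈ₗ (a ∷ b ∷ c ∷ [])
  on-tri₁ _ here = here refl
  on-tri₁ _ (there here) = there (here refl)
  on-tri₁ _ (there (there here)) = there (there (here refl))
  on-tri₁ _ (there (there (there (there (there (there ()))))))
  on-tri₂ : ∀ i → i ∈ F-tri₂ → φ i ∈ₗ (d ∷ e ∷ f ∷ [])
  on-tri₂ _ (there (there (there here))) = here refl
  on-tri₂ _ (there (there (there (there here)))) = there (here refl)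
  on-tri₂ _ (there (there (there (there (there here))))) = there (there (here refl))
  on-pair : ∀ i → i ∈ F-pair → φ i ∈ₗ (a ∷ d ∷ [])
  on-pair _ here = here refl
  on-pair _ (there (there (there here))) = there (here refl)
  on-pair _ (there (there (there (there (there (there ()))))))
  preserves : ∀ s → edge F s ≡ true → edge H (image φ s) ≡ true
  preserves s s∈F with s ⊆? F-tri₁ | s ⊆? F-tri₂ | s ⊆? F-pair
  ... | yes s⊆ | _ | _ = down-closed H _ _ (image⊆ s F-tri₁ _ on-tri₁ s⊆) abc
  ... | no _ | yes s⊆ | _ = down-closed H _ _ (image⊆ s F-tri₂ _ on-tri₂ s⊆) def
  ... | no _ | no _ | yes s⊆ = down-closed H _ _ (image⊆ s F-pair _ on-pair s⊆) ad
  preserves s () | no _ | no _ | no _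

others : (v w : Fin (2 + k)) → v ≢ w → List (Fin (2 + k))
others v w v≢w = map (λ i → punchIn v (punchIn (punchOut v≢w) i)) (allFin _)

∈-others : ∀ {v w z : Fin (2 + k)} (v≢w : v ≢ w) → z ≢ v → z ≢ w → z ∈ₗ others v w v≢w
∈-others {k} {v} {w} {z} v≢w z≢v z≢w = subst (_∈ₗ others v w v≢w) eq (∈-map⁺ _ (∈-allFin i))
  where
  v≢z = ≢-sym z≢v
  w′≢z′ : punchOut v≢w ≢ punchOut v≢z
  w′≢z′ eq = z≢w (sym (punchOut-injective v≢w v≢z eq))
  i = punchOut w′≢z′
  eq : punchIn v (punchIn (punchOut v≢w) i) ≡ z
  eq = trans (cong (punchIn v) (punchIn-punchOut w′≢z′)) (punchIn-punchOut v≢z)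

-- One triple for each of the m - 1 remaining vertices; the form `suc (length L) ≡ m` avoids
-- truncated subtraction.
triples : (v w : Fin (suc m)) → v ≢ w → Σ (List (Subset (suc m))) λ L →
  suc (length L) ≡ m × (∀ z → z ≢ v → z ≢ w → setOf (v ∷ w ∷ z ∷ []) ∈ₗ L)
triples {zero} zero zero v≢w = contradiction refl v≢w
triples {suc k} v w v≢w =
  map (λ z → setOf (v ∷ w ∷ z ∷ [])) (others v w v≢w) ,
  cong suc (trans (length-map _ (others v w v≢w)) (trans (length-map _ (allFin k)) (length-tabulate id))) ,
  λ z z≢v z≢w → ∈-map⁺ _ (∈-others v≢w z≢v z≢w)

-- A large F-free complex has a vertex of small degree

module Dense {m} (H : Complex (suc m)) (F-free : ¬ ContainsCopy H F)
             (large : ∀ {l} → l ≤ 13 → 2 ^ l < m) (dense : ∀ v → m + m < degree H v) where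

  V = Fin (suc m)

  Tri : V → V → V → Set
  Tri = Triangle H

  tri : ∀ {a b c s} → a ∈ s → b ∈ s → c ∈ s → edge H s ≡ true → a ≢ b → a ≢ c → b ≢ c → Tri a b c
  tri a∈ b∈ c∈ s∈H a≢b a≢c b≢c = triangle a≢b a≢c b≢c (face-⊆ H (a∈ ∷ b∈ ∷ c∈ ∷ []) s∈H)

  -- Here `z` may equal `v`, which contributes the singleton: these m + 1 sets are all the sets of
  -- at most two vertices containing `v`.
  pairs : V → List (Subset (suc m))
  pairs v = map (λ z → setOf (v ∷ z ∷ [])) (allFin _)

  length-pairs : ∀ v → length (pairs v) ≡ suc m
  length-pairs v = trans (length-map _ (allFin (suc m))) (length-tabulate id)

  ∈-pairs : ∀ v z → setOf (v ∷ z ∷ []) ∈ₗ pairs v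
  ∈-pairs v z = ∈-map⁺ _ (∈-allFin z)

  -- The longest list used later has 3 + 3 · 3 = 12 vertices, in `light-triangle`; adding `v` gives
  -- the exponent 13 in `large`.
  few-small-sets : ∀ v W → length W ≤ 12 → length (pairs v ++ powerset (v ∷ W)) ≤ m + m
  few-small-sets v W |W|≤12 = begin
    length (pairs v ++ powerset (v ∷ W))          ≡⟨ length-++ (pairs v) ⟩
    length (pairs v) + length (powerset (v ∷ W))  ≡⟨ cong₂ _+_ (length-pairs v) (length-powerset (v ∷ W)) ⟩
    suc m + 2 ^ suc (length W)                    ≡⟨ +-suc m (2 ^ suc (length W)) ⟨
    m + suc (2 ^ suc (length W))                  ≤⟨ +-monoʳ-≤ m (large (s≤s |W|≤12)) ⟩
    m + m                                         ∎
    where open ≤-Reasoning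

  -- An edge at `v` outside the list is not contained in `v ∷ W`, which gives `a`, and is not the
  -- pair of `v` and `a`, which gives `b`. Only `a` is kept out of `W`.
  triangle-leaving : ∀ v W → length W ≤ 12 → ∃₂ λ a b → Tri v a b × All (a ≢_) W
  triangle-leaving v W |W|≤12
    with s , v∈s , s∈H , s∉ ← degree-uncovered H v (pairs v ++ powerset (v ∷ W))
           (≤-trans (s≤s (few-small-sets v W |W|≤12)) (dense v))
    with a , a∈s , a≢v ∷ a∉W ← outside-member s (v ∷ W)
           (λ s⊆ → s∉ (∈-++⁺ʳ (pairs v) (∈-powerset (v ∷ W) s⊆)))
    with b , b∈s , b≢v ∷ b≢a ∷ [] ← extra-member s (v ∷ a ∷ []) (v∈s ∷ a∈s ∷ [])
           (λ { refl → s∉ (∈-++⁺ˡ (∈-pairs v a)) })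
    = a , b , tri v∈s a∈s b∈s s∈H (≢-sym a≢v) (≢-sym b≢v) (≢-sym b≢a) , a∉W

  length-pairs-++ : ∀ v L → suc (length L) ≡ m → length (pairs v ++ L) ≡ m + m
  length-pairs-++ v L |L| = trans (length-++ (pairs v)) (trans (cong (_+ length L) (length-pairs v))
    (trans (sym (+-suc m (length L))) (cong (m +_) |L|)))

  -- The listed sets number exactly (m + 1) + (m - 1) = 2m. An edge outside the list either misses
  -- `w` and has at least three vertices, or contains `w` and has at least four. The threshold is
  -- sharp: in the cone, a base vertex has degree 2m and all its triangles contain the apex.
  triangle-avoiding : ∀ v w → v ≢ w → ∃₂ λ a b → Tri v a b × a ≢ w × b ≢ w
  triangle-avoiding v w v≢w
    with L , |L| , ∈L ← triples v w v≢w
    with s , v∈s , s∈H , s∉ ← degree-uncovered H v (pairs v ++ L)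
           (≤-trans (s≤s (≤-reflexive (length-pairs-++ v L |L|))) (dense v))
    with w ∈? s
  ... | no w∉s
    -- `v` is repeated because the singleton is listed as `setOf (v ∷ v ∷ [])`.
    with a , a∈s , a≢v ∷ _ ← extra-member s (v ∷ v ∷ []) (v∈s ∷ v∈s ∷ [])
           (λ { refl → s∉ (∈-++⁺ˡ (∈-pairs v v)) })
    with b , b∈s , b≢v ∷ b≢a ∷ [] ← extra-member s (v ∷ a ∷ []) (v∈s ∷ a∈s ∷ [])
           (λ { refl → s∉ (∈-++⁺ˡ (∈-pairs v a)) })
    = a , b , tri v∈s a∈s b∈s s∈H (≢-sym a≢v) (≢-sym b≢v) (≢-sym b≢a) ,
      (λ { refl → w∉s a∈s }) , (λ { refl → w∉s b∈s })
  ... | yes w∈s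
    with a , a∈s , a≢v ∷ a≢w ∷ [] ← extra-member s (v ∷ w ∷ []) (v∈s ∷ w∈s ∷ [])
           (λ { refl → s∉ (∈-++⁺ˡ (∈-pairs v w)) })
    with b , b∈s , b≢v ∷ b≢w ∷ b≢a ∷ [] ← extra-member s (v ∷ w ∷ a ∷ []) (v∈s ∷ w∈s ∷ a∈s ∷ [])
           (λ { refl → s∉ (∈-++⁺ʳ (pairs v) (∈L a a≢v a≢w)) })
    = a , b , tri v∈s a∈s b∈s s∈H (≢-sym a≢v) (≢-sym b≢v) (≢-sym b≢a) , a≢w , b≢w

  free : ∀ {a b c d e f} → Tri a b c → Tri d e f → Face H (a ∷ d ∷ []) →
    a ≢ d → a ≢ e → a ≢ f → b ≢ d → b ≢ e → b ≢ f → c ≢ d → c ≢ e → c ≢ f → Absurd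
  free (triangle a≢b a≢c b≢c abc) (triangle d≢e d≢f e≢f def) ad
       a≢d a≢e a≢f b≢d b≢e b≢f c≢d c≢e c≢f = F-free (joined-triangles H
    ((a≢b ∷ a≢c ∷ a≢d ∷ a≢e ∷ a≢f ∷ []) ∷ (b≢c ∷ b≢d ∷ b≢e ∷ b≢f ∷ []) ∷
     (c≢d ∷ c≢e ∷ c≢f ∷ []) ∷ (d≢e ∷ d≢f ∷ []) ∷ (e≢f ∷ []) ∷ [] ∷ []) abc def ad)

  -- wx is contained in at least four triangles, stated negatively: no list of at most three
  -- vertices contains all third vertices.  So ¬ Heavy w x yields such a list when proving Absurd.
  Heavy : V → V → Set
  Heavy w x = ∀ W → length W ≤ 3 → ¬ (∀ y → Tri w x y → ¬ All (y ≢_) W)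

  heavy-sym : ∀ {w x} → Heavy w x → Heavy x w
  heavy-sym heavy W |W|≤3 light = heavy W |W|≤3 λ y t → light y (swap₁₂ t)

  -- Heaviness supplies a triangle `wxy′` with `y′` outside `y ∷ p ∷ q ∷ []`. It would be disjoint
  -- from `ypq` and joined to it by the edge between `y` and `w`.
  triangles-meet-heavy : ∀ {w x y p q} → Heavy w x → Tri w x y → Tri y p q →
    p ≢ w → p ≢ x → q ≢ w → q ≢ x → Absurd
  triangles-meet-heavy {y = y} {p} {q} heavy wxy ypq p≢w p≢x q≢w q≢x =
    heavy (y ∷ p ∷ q ∷ []) ≤-refl λ { y′ wxy′ (y′≢y ∷ y′≢p ∷ y′≢q ∷ []) →
      free ypq wxy′ (triangle-edge (swap₁₂ (swap₂₃ wxy)))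
        (≢-sym (a≢c wxy)) (≢-sym (b≢c wxy)) (≢-sym y′≢y)
        p≢w p≢x (≢-sym y′≢p) q≢w q≢x (≢-sym y′≢q) }
    where open Triangle

  -- Heaviness supplies a triangle `ywu` disjoint from `y′xz`, and the edge between `w` and `x`
  -- joins the two. So a triangle at `y′` that contains `x` and avoids `w` can only have `y` as its
  -- third vertex.
  triangle-through-heavy : ∀ {w x y y′ z} → Heavy y w → Tri w x y′ → y′ ≢ y → x ≢ y →
    Tri y′ x z → z ≢ w → z ≢ y → Absurd
  triangle-through-heavy {w} {x} {y} {y′} {z} heavy wxy′ y′≢y x≢y y′xz z≢w z≢y =
    heavy (z ∷ y′ ∷ x ∷ []) ≤-refl λ { u ywu (u≢z ∷ u≢y′ ∷ u≢x ∷ []) →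
      free (swap₁₂ y′xz) (swap₁₂ ywu) (triangle-edge (swap₁₂ wxy′))
        (≢-sym (a≢b wxy′)) x≢y (≢-sym u≢x)
        (≢-sym (a≢c wxy′)) y′≢y (≢-sym u≢y′)
        z≢w z≢y (≢-sym u≢z) }
    where open Triangle

  -- Given a list `W` of third vertices, take a triangle `y′pq` with `p` outside `w`, `x`, `y` and
  -- `W`. If `q` is `w`, then `W` was incomplete; if `q` is `x`, then `triangle-through-heavy`
  -- applies, as `p ≢ y`; any other `q` gives a triangle missing both `w` and `x`.
  heavy-spreads : ∀ {w x y y′} → Heavy w x → Tri w x y → Heavy y w → Tri w x y′ → y′ ≢ y →
    Heavy y′ w
  heavy-spreads {w} {x} {y} {y′} wx wxy yw wxy′ y′≢y W |W|≤3 light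
    with p , q , y′pq , p≢w ∷ p≢x ∷ p≢y ∷ p∉W ←
           triangle-leaving y′ (w ∷ x ∷ y ∷ W) (≤-trans (+-monoʳ-≤ 3 |W|≤3) (m≤m+n 6 6))
    with q ≟ w | q ≟ x
  ... | yes refl | _ = light p (swap₂₃ y′pq) p∉W
  ... | no _ | yes refl =
    triangle-through-heavy yw wxy′ y′≢y (Triangle.b≢c wxy) (swap₂₃ y′pq) p≢w p≢y
  ... | no q≢w | no q≢x = triangles-meet-heavy wx wxy′ y′pq p≢w p≢x q≢w q≢x

  -- Take two further third vertices `y₁` and `y₂`. The pairs `y`, `w` and `y₁`, `w` are both heavy
  -- and together exclude every triangle `y₂xz` with `z ≢ w`. So all triangles at `y₂` contain `w`,
  -- contrary to `triangle-avoiding`.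
  ¬two-heavy-sides : ∀ {w x y} → Heavy w x → Tri w x y → ¬ Heavy y w
  ¬two-heavy-sides {w} {x} {y} wx wxy yw =
    wx (y ∷ []) (s≤s z≤n) λ { y₁ wxy₁ (y₁≢y ∷ []) →
    wx (y ∷ y₁ ∷ []) (s≤s (s≤s z≤n)) λ { y₂ wxy₂ (y₂≢y ∷ y₂≢y₁ ∷ []) →
    third wxy₁ wxy₂ y₁≢y y₂≢y y₂≢y₁ } }
    where
    open Triangle
    third : ∀ {y₁ y₂} → Tri w x y₁ → Tri w x y₂ → y₁ ≢ y → y₂ ≢ y → y₂ ≢ y₁ → Absurd
    third {y₁} {y₂} wxy₁ wxy₂ y₁≢y y₂≢y y₂≢y₁ = conclude
      where
      not-through-x : ∀ {z} → Tri y₂ x z → z ≢ w → Absurd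
      not-through-x {z} y₂xz z≢w with z ≟ y
      ... | no z≢y = triangle-through-heavy yw wxy₂ y₂≢y (b≢c wxy) y₂xz z≢w z≢y
      -- The exception `z = y` left by the first heavy pair is excluded by the second, because `y`
      -- differs from `y₁`.
      ... | yes refl = triangle-through-heavy (heavy-spreads wx wxy yw wxy₁ y₁≢y)
              wxy₂ y₂≢y₁ (b≢c wxy₁) y₂xz z≢w (≢-sym y₁≢y)
      conclude : Absurd
      conclude with p , q , y₂pq , p≢w , q≢w ← triangle-avoiding y₂ w (≢-sym (a≢c wxy₂))
               with p ≟ x | q ≟ x
      ... | yes refl | _ = not-through-x y₂pq q≢w
      ... | no _ | yes refl = not-through-x (swap₂₃ y₂pq) p≢w
      ... | no p≢x | no q≢x = triangles-meet-heavy wx wxy₂ y₂pq p≢w p≢x q≢w q≢x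

  -- The empty list yields some `y`, and `y` forms a heavy pair with neither `w` nor `x`. A triangle
  -- at `y` leaving `w`, `x` and both lists of third vertices then misses `w` and `x`, contrary to
  -- `triangles-meet-heavy`.
  ¬heavy : ∀ {w x} → ¬ Heavy w x
  ¬heavy {w} {x} wx = wx [] z≤n λ y wxy _ →
    ¬two-heavy-sides wx wxy λ W₁ |W₁|≤3 light₁ →
    ¬two-heavy-sides (heavy-sym wx) (swap₁₂ wxy) λ W₂ |W₂|≤3 light₂ →
    light-sides wxy W₁ W₂ |W₁|≤3 |W₂|≤3 light₁ light₂
    where
    light-sides : ∀ {y} → Tri w x y → ∀ W₁ W₂ → length W₁ ≤ 3 → length W₂ ≤ 3 →
      (∀ z → Tri y w z → ¬ All (z ≢_) W₁) → (∀ z → Tri y x z → ¬ All (z ≢_) W₂) → Absurd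
    light-sides {y} wxy W₁ W₂ |W₁|≤3 |W₂|≤3 light₁ light₂
      with p , q , ypq , p≢w ∷ p≢x ∷ p∉W ← triangle-leaving y (w ∷ x ∷ W₁ ++ W₂)
             (≤-trans (s≤s (s≤s (≤-trans (≤-reflexive (length-++ W₁)) (+-mono-≤ |W₁|≤3 |W₂|≤3)))) (m≤m+n 8 4))
      with q ≟ w | q ≟ x
    ... | yes refl | _ = light₁ p (swap₂₃ ypq) (++⁻ˡ W₁ p∉W)
    ... | no _ | yes refl = light₂ p (swap₂₃ ypq) (++⁻ʳ W₁ p∉W)
    ... | no q≢w | no q≢x = triangles-meet-heavy wx wxy ypq p≢w p≢x q≢w q≢x

  -- A triangle `wpq` with `p` outside `v`, `a`, `b` and the three lists cannot contain `v`, `a` or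
  -- `b`. So it is disjoint from `vab`, while the edge between `w` and `v` joins them.
  light-triangle : ∀ {v a b w u} → Tri v a b → Tri w v u → w ≢ a → w ≢ b →
    ∀ W₁ W₂ W₃ → length W₁ ≤ 3 → length W₂ ≤ 3 → length W₃ ≤ 3 →
    (∀ z → Tri w v z → ¬ All (z ≢_) W₁) → (∀ z → Tri w a z → ¬ All (z ≢_) W₂) →
    (∀ z → Tri w b z → ¬ All (z ≢_) W₃) → Absurd
  light-triangle {v} {a} {b} {w} vab wv- w≢a w≢b W₁ W₂ W₃ |W₁|≤3 |W₂|≤3 |W₃|≤3 light₁ light₂ light₃
    with p , q , wpq , p≢v ∷ p≢a ∷ p≢b ∷ p∉W ← triangle-leaving w (v ∷ a ∷ b ∷ W₁ ++ W₂ ++ W₃)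
           (+-monoʳ-≤ 3 (≤-trans (≤-reflexive (trans (length-++ W₁) (cong (length W₁ +_) (length-++ W₂))))
             (+-mono-≤ |W₁|≤3 (+-mono-≤ |W₂|≤3 |W₃|≤3))))
    with q ≟ v | q ≟ a | q ≟ b
  ... | yes refl | _ | _ = light₁ p (swap₂₃ wpq) (++⁻ˡ W₁ p∉W)
  ... | no _ | yes refl | _ = light₂ p (swap₂₃ wpq) (++⁻ˡ W₂ (++⁻ʳ W₁ p∉W))
  ... | no _ | no _ | yes refl = light₃ p (swap₂₃ wpq) (++⁻ʳ W₂ (++⁻ʳ W₁ p∉W))
  ... | no q≢v | no q≢a | no q≢b =
    free wpq vab (triangle-edge wv-) (Triangle.a≢b wv-) w≢a w≢b p≢v p≢a p≢b q≢v q≢a q≢b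

  absurd : Absurd
  absurd
    with a , b , vab , _ ← triangle-leaving zero [] z≤n
    -- A second triangle at `zero` provides a neighbour off the first one.
    with w , _ , vw- , w≢a ∷ w≢b ∷ [] ← triangle-leaving zero (a ∷ b ∷ []) (s≤s (s≤s z≤n))
    = ¬heavy λ W₁ |W₁|≤3 light₁ → ¬heavy λ W₂ |W₂|≤3 light₂ → ¬heavy λ W₃ |W₃|≤3 light₃ →
      light-triangle vab (swap₁₂ vw-) w≢a w≢b W₁ W₂ W₃ |W₁|≤3 |W₂|≤3 |W₃|≤3 light₁ light₂ light₃

-- Induction on the number of vertices

low-degree-vertex : (H : Complex (suc m)) → ¬ ContainsCopy H F →
  (∀ {l} → l ≤ 13 → 2 ^ l < m) →
  ∃ λ v → degree H v ≤ m + m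
low-degree-vertex {m} H F-free large with any? (λ v → degree H v ≤? m + m)
... | yes found = found
... | no none = ⊥-elim (Dense.absurd H F-free large λ v → ≰⇒> λ low → none (v , low))

m≤m*m : ∀ m → m ≤ m * m
m≤m*m zero = z≤n
m≤m*m (suc m) = m≤m+n (suc m) (m * suc m)

-- Up to `N` vertices, counting all subsets suffices. Beyond that, deleting a vertex of low degree
-- costs at most 2m = (m + 1)m - m(m - 1) edges, so the constant `2 ^ N` is preserved.
upper-bound : ∀ N → (∀ {l} → l ≤ 13 → 2 ^ l < N) → ∀ n (H : Complex n) → ¬ ContainsCopy H F →
  numEdges H ≤ n * n ∸ n + 2 ^ N
upper-bound N large n H F-free with n ≤? N
... | yes n≤N = ≤-trans (∑-bool≤2^n (edge H)) (≤-trans (^-monoʳ-≤ 2 n≤N) (m≤n+m _ (n * n ∸ n)))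
upper-bound N large zero H F-free | no 0≰N = contradiction z≤n 0≰N
upper-bound N large (suc m) H F-free | no m≮N
  with N≤m ← ≤-pred (≰⇒> m≮N)
  with v , low ← low-degree-vertex H F-free (λ l≤13 → ≤-trans (large l≤13) N≤m) = begin
  numEdges H                           ≡⟨ numEdges-delete H v ⟩
  numEdges (delete H v) + degree H v   ≤⟨ +-mono-≤ (upper-bound N large m (delete H v) (F-free ∘ delete-copy {G = F} H v)) low ⟩
  (m * m ∸ m + 2 ^ N) + (m + m)        ≡⟨ rearrange (m * m ∸ m) (2 ^ N) m ⟩
  (m * m ∸ m + m) + m + 2 ^ N          ≡⟨ cong (λ x → x + m + 2 ^ N) (m∸n+n≡m (m≤m*m m)) ⟩
  m * m + m + 2 ^ N                    ≡⟨ cong (_+ 2 ^ N) (trans (+-comm (m * m) m) (sym (*-suc m m))) ⟩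
  m * suc m + 2 ^ N                    ≡⟨ cong (_+ 2 ^ N) (n*n∸n m) ⟨
  suc m * suc m ∸ suc m + 2 ^ N        ∎
  where
  open ≤-Reasoning
  rearrange : ∀ a b c → (a + b) + (c + c) ≡ a + c + c + b
  rearrange = solve-∀

theorem1p4 : Σ ℕ λ C → ∀ (n : ℕ) → .{{_ : NonZero n}} →
    (Σ (Complex n) λ H → (¬ ContainsCopy H F) × (n * n ∸ n + 2 ≤ numEdges H))
    × (∀ (H : Complex n) → ¬ ContainsCopy H F → numEdges H ≤ n * n ∸ n + C)
-- `N` is 2 ^ 13 + 1, the least number exceeding `2 ^ l` for all `l ≤ 13`, and the constant is
-- `2 ^ N`.
theorem1p4 = 2 ^ suc (2 ^ 13) , λ where
  (suc m) → (cone , cone-F-free , ≤-reflexive (sym (numEdges-cone m))) ,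
            upper-bound (suc (2 ^ 13)) (λ l≤13 → s≤s (^-monoʳ-≤ 2 l≤13)) (suc m)
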